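{- Let $\pi'$ and $\pi''$ be two non-increasing tree degree sequences of the same length $n$ with $\pi'\triangleleft\pi''$. Then \[\operatorname{Ecc}(T^*_{\pi'})\geq \operatorname{Ecc}(T^*_{\pi''}),\] where $T^*_\nu$ denotes the greedy tree for degree sequence $\nu$.
   Context: For a vertex $v$ of a tree $T$, $\operatorname{ecc}_T(v)=\max_{u\in V(T)} d_T(u,v)$, and $\operatorname{Ecc}(T)=\sum_{z\in V(T)}\operatorname{ecc}_T(z)$. For non-increasing sequences $\pi'=(d'_1,\ldots,d'_n)$ and $\pi''=(d''_1,\ldots,d''_n)$, $\pi'\triangleleft\pi''$ ($\pi''$ majorizes $\pi'$) means $\sum_{i=1}^k d'_i\leq\sum_{i=1}^k d''_i$ for all $k\in[n-1]$ and $\sum_{i=1}^n d'_i=\sum_{i=1}^n d''_i$. Greedy tree for a tree degree sequence $d_1\geq\cdots\geq d_n$: the rooted tree built level by level where the root has degree $d_1$, the vertices at height 1 receive degrees $d_2,\ldots,d_{d_1+1}$, and each subsequent level (with as many vertices as the total down-degree of the previous level) receives the next largest unused degrees; within each level vertices are ordered left to right by non-increasing degree, and processing each level left to right, each vertex is joined to the first as yet unconnected vertices of the next level, as many as its down-degree (degree for the root, degree minus one otherwise). -}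

module Defs where

open import Data.Nat using (ℕ; zero; suc; _+_; _*_; _∸_; _≤_; _<_; _⊔_; _≡ᵇ_; _<ᵇ_; _≤ᵇ_)
open import Data.Bool using (Bool; true; false; _∧_; _∨_; if_then_else_)
open import Data.Fin using (Fin; toℕ; _≤_)
open import Data.Vec using (Vec; lookup; toList)
open import Data.List using (List; []; _∷_; take; foldr; map; allFin)
open import Data.Nat.ListAction using (sum)
open import Data.Bool.ListAction using (any)
open import Data.Product using (_×_)
open import Data.Sum using (_⊎_)
open import Relation.Binary.PropositionalEquality using (_≡_)

NonIncreasing : ∀ {n} → Vec ℕ n → Set
NonIncreasing {n} d = ∀ (i j : Fin n) → i Data.Fin.≤ j → lookup d j Data.Nat.≤ lookup d i

IsTreeDegSeq : ∀ {n} → Vec ℕ n → Set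
IsTreeDegSeq {n} d =
  (n ≡ 1 × toList d ≡ 0 ∷ [])
  ⊎ (2 Data.Nat.≤ n × (∀ i → 1 Data.Nat.≤ lookup d i) × sum (toList d) ≡ 2 * (n ∸ 1))

_◁_ : ∀ {n} → Vec ℕ n → Vec ℕ n → Set
_◁_ {n} d' d'' =
  (∀ k → 1 Data.Nat.≤ k → k Data.Nat.< n →
     sum (take k (toList d')) Data.Nat.≤ sum (take k (toList d'')))
  × sum (toList d') ≡ sum (toList d'')

-- Greedy tree T*_d on vertex set Fin n, vertices numbered 0,1,...,n-1 in
-- breadth-first (level by level, left to right) order; vertex i gets degree d_i.

at : List ℕ → ℕ → ℕ
at []       _       = 0
at (x ∷ _)  zero    = x
at (_ ∷ xs) (suc i) = at xs i

downDeg : List ℕ → ℕ → ℕ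
downDeg ds zero    = at ds zero
downDeg ds (suc i) = at ds (suc i) ∸ 1

-- number of non-root vertices already used as children of vertices 0..i-1
used : List ℕ → ℕ → ℕ
used ds zero    = 0
used ds (suc i) = used ds i + downDeg ds i

-- j is a child of i: j is among the next downDeg i unconnected vertices,
-- i.e. used i < j ≤ used (i+1)   (and i < j)
childB : List ℕ → ℕ → ℕ → Bool
childB ds i j = (i <ᵇ j) ∧ (used ds i <ᵇ j) ∧ (j ≤ᵇ used ds (suc i))

greedyAdj : ∀ {n} → Vec ℕ n → Fin n → Fin n → Bool
greedyAdj d u v = childB (toList d) (toN u) (toN v) ∨ childB (toList d) (toN v) (toN u)
  where toN = toℕ

_==_ : ∀ {n} → Fin n → Fin n → Bool
u == v = toℕ u ≡ᵇ toℕ v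

within : ∀ {n} → (Fin n → Fin n → Bool) → ℕ → Fin n → Fin n → Bool
within adj zero    u v = u == v
within adj (suc k) u v =
  within adj k u v ∨ any (λ w → within adj k u w ∧ adj w v) (allFin _)

search : ∀ {n} → (Fin n → Fin n → Bool) → Fin n → Fin n → ℕ → ℕ → ℕ
search adj u v s zero       = s
search adj u v s (suc fuel) =
  if within adj s u v then s else search adj u v (suc s) fuel

-- shortest-path distance (graphs here are connected, so distance < n)
dist : ∀ {n} → (Fin n → Fin n → Bool) → Fin n → Fin n → ℕ
dist {n} adj u v = search adj u v 0 n

ecc : ∀ {n} → (Fin n → Fin n → Bool) → Fin n → ℕ
ecc {n} adj z = foldr _⊔_ 0 (map (dist adj z) (allFin n))

Ecc : ∀ {n} → (Fin n → Fin n → Bool) → ℕ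
Ecc {n} adj = sum (map (ecc adj) (allFin n))

{-# OPTIONS --safe #-}
module Submission where

-- Number the vertices in breadth-first order, so that a greedy tree is given by its monotone parent
-- function, and call a vertex "first" if it lies in the branch of vertex 1.  Two vertices have distance
-- at most the sum of their depths, with equality if exactly one of them is first and strict inequality
-- if both are.  All leaves lie on the last two levels, so writing H for the height of the tree, ecc v is
-- depth v + H, or depth v + H − 1 when v and the whole last level are first.  Majorization increases the
-- number of children of every initial segment, hence decreases parents and depths, and it preserves
-- firstness of vertices whose depth is unchanged.  So ecc decreases at every vertex number.

open import Defs
open import Algebra.Properties.CommutativeSemigroup using (interchange)
open import Data.Bool using (Bool; true; false; T)
open import Data.Bool.Properties using (T-∧; T-∨; T-≡; ∨-comm)
open import Data.Empty using (⊥-elim)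
open import Data.Fin using (Fin; toℕ; fromℕ<)
open import Data.Fin.Properties using (toℕ<n; toℕ-fromℕ<; toℕ-injective)
open import Data.List using (List; []; _∷_; take; foldr; map; allFin; length)
open import Data.List.Membership.Propositional using (_∈_; lose)
open import Data.List.Membership.Propositional.Properties using (∈-allFin)
open import Data.List.Properties using (take-all)
open import Data.List.Relation.Unary.Any using (here; there; satisfied)
open import Data.List.Relation.Unary.Any.Properties using (any⁺; any⁻)
open import Data.Nat using (ℕ; zero; suc; _<ᵇ_; _+_; _*_; _∸_; _⊔_; _≤_; _<_; _≥_; z≤n; s≤s; s≤s⁻¹; z<s; _≤?_; _<?_)
open import Data.Nat.ListAction using (sum)
open import Data.Nat.Properties
open import Data.Product using (∃; _×_; _,_; proj₁; proj₂)
open import Data.Sum using (_⊎_; inj₁; inj₂)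
open import Data.Vec using (Vec; toList; lookup; _∷_; [])
open import Data.Vec.Properties using (length-toList)
open import Function using (_∘_; const)
open import Function.Bundles using (Equivalence)
open import Relation.Binary.PropositionalEquality using (_≡_; _≢_; refl; sym; trans; cong; subst; subst₂; module ≡-Reasoning)
open import Relation.Nullary using (yes; no; contradiction)

-- Distances and eccentricities

module Distance {n : ℕ} (adj : Fin n → Fin n → Bool) where

  Within : ℕ → Fin n → Fin n → Set
  Within k u v = T (within adj k u v)

  within-refl : ∀ {u v} → toℕ u ≡ toℕ v → Within 0 u v
  within-refl {u} {v} = ≡⇒≡ᵇ (toℕ u) (toℕ v)

  within-suc⁺ : ∀ {k u v} → Within k u v → Within (suc k) u v
  within-suc⁺ = Equivalence.from T-∨ ∘ inj₁

  within-snoc : ∀ {k u w v} → Within k u w → T (adj w v) → Within (suc k) u v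
  within-snoc {w = w} uw wv =
    Equivalence.from T-∨ (inj₂ (any⁺ _ (lose (∈-allFin w) (Equivalence.from T-∧ (uw , wv)))))

  within-suc⁻ : ∀ {k u v} → Within (suc k) u v →
                Within k u v ⊎ ∃ λ w → Within k u w × T (adj w v)
  within-suc⁻ uv with Equivalence.to T-∨ uv
  ... | inj₁ uv′ = inj₁ uv′
  ... | inj₂ s   with satisfied (any⁻ _ (allFin n) s)
  ...   | w , p = inj₂ (w , Equivalence.to T-∧ p)

  within-edge : ∀ {u v} → T (adj u v) → Within 1 u v
  within-edge {u} {v} = within-snoc {0} {u} {u} {v} (within-refl {u} {u} refl)

  within-trans : ∀ k l {u w v} → Within k u w → Within l w v → Within (l + k) u v
  within-trans k zero    {u} {w} {v} uw wv =
    subst (Within k u) (toℕ-injective (≡ᵇ⇒≡ (toℕ w) (toℕ v) wv)) uw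
  within-trans k (suc l) {u} {w} {v} uw wv with within-suc⁻ {l} {w} {v} wv
  ... | inj₁ wv′            = within-suc⁺ {l + k} {u} {v} (within-trans k l {u} {w} {v} uw wv′)
  ... | inj₂ (x , wx , xv)  =
    within-snoc {l + k} {u} {x} {v} (within-trans k l {u} {w} {x} uw wx) xv

  within-sym : (∀ {u v} → T (adj u v) → T (adj v u)) → ∀ k {u v} → Within k u v → Within k v u
  within-sym adj-sym zero    {u} {v} uv = ≡⇒≡ᵇ (toℕ v) (toℕ u) (sym (≡ᵇ⇒≡ (toℕ u) (toℕ v) uv))
  within-sym adj-sym (suc k) {u} {v} uv with within-suc⁻ {k} {u} {v} uv
  ... | inj₁ uv′           = within-suc⁺ {k} {v} {u} (within-sym adj-sym k {u} {v} uv′)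
  ... | inj₂ (w , uw , wv) = subst (λ m → Within m v u) (+-comm k 1)
        (within-trans 1 k {v} {w} {u} (within-edge {v} {w} (adj-sym wv)) (within-sym adj-sym k {u} {w} uw))

  -- Potentials that change by at most one along an edge; such a potential bounds distances from
  -- below. Two inequalities replace the absolute difference.
  Lipschitz : (Fin n → ℕ) → Set
  Lipschitz g = ∀ u v → T (adj u v) → g u ≤ suc (g v) × g v ≤ suc (g u)

  within-lipschitz : ∀ {g} → Lipschitz g → ∀ k {u v} → Within k u v →
                     g u ≤ g v + k × g v ≤ g u + k
  within-lipschitz {g} lip zero {u} {v} uv
    with refl ← toℕ-injective {i = u} {j = v} (≡ᵇ⇒≡ (toℕ u) (toℕ v) uv) = m≤m+n _ 0 , m≤m+n _ 0
  within-lipschitz {g} lip (suc k) {u} {v} uv with within-suc⁻ {k} {u} {v} uv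
  ... | inj₁ uv′ = let (a , b) = within-lipschitz lip k {u} {v} uv′ in
        ≤-trans a (+-monoʳ-≤ (g v) (n≤1+n k)) , ≤-trans b (+-monoʳ-≤ (g u) (n≤1+n k))
  ... | inj₂ (w , uw , wv) = let (a , b) = within-lipschitz lip k {u} {w} uw ; (c , d) = lip w v wv in
        ≤-trans a (≤-trans (+-monoˡ-≤ k c) (≤-reflexive (sym (+-suc (g v) k)))) ,
        ≤-trans d (≤-trans (s≤s b) (≤-reflexive (sym (+-suc (g u) k))))

  search-≤ : ∀ u v s f {k} → s ≤ k → Within k u v → search adj u v s f ≤ k
  search-≤ u v s zero    s≤k uv = s≤k
  search-≤ u v s (suc f) {k} s≤k uv with within adj s u v in eq
  ... | true  = s≤k
  ... | false = search-≤ u v (suc s) f (≤∧≢⇒< s≤k s≢k) uv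
    where
    s≢k : s ≢ k
    s≢k refl = subst T eq uv

  search-within : ∀ u v s f → Within (search adj u v s f) u v ⊎ search adj u v s f ≡ s + f
  search-within u v s zero = inj₂ (sym (+-identityʳ s))
  search-within u v s (suc f) with within adj s u v in eq
  ... | true  = inj₁ (Equivalence.from T-≡ eq)
  ... | false with search-within u v (suc s) f
  ...   | inj₁ w = inj₁ w
  ...   | inj₂ e = inj₂ (trans e (sym (+-suc s f)))

  dist-≤ : ∀ u v {k} → Within k u v → dist adj u v ≤ k
  dist-≤ u v = search-≤ u v 0 n z≤n

  -- A search that runs out of fuel returns n, hence the hypothesis b ≤ n.
  dist-≥ : ∀ u v {b} → b ≤ n → (∀ k → Within k u v → b ≤ k) → b ≤ dist adj u v
  dist-≥ u v b≤n low with search-within u v 0 n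
  ... | inj₁ w = low _ w
  ... | inj₂ e = ≤-trans b≤n (≤-reflexive (sym e))

  dist≤ecc : ∀ u v → dist adj u v ≤ ecc adj u
  dist≤ecc u v = go (∈-allFin v)
    where
    go : ∀ {xs} → v ∈ xs → dist adj u v ≤ foldr _⊔_ 0 (map (dist adj u) xs)
    go (here refl) = m≤m⊔n _ _
    go (there v∈)  = ≤-trans (go v∈) (m≤n⊔m _ _)

  ecc-≤ : ∀ u {b} → (∀ v → dist adj u v ≤ b) → ecc adj u ≤ b
  ecc-≤ u {b} h = go (allFin n)
    where
    go : ∀ xs → foldr _⊔_ 0 (map (dist adj u) xs) ≤ b
    go []       = z≤n
    go (x ∷ xs) = ⊔-lub (h x) (go xs)

sum-map-mono : ∀ {A : Set} {f g : A → ℕ} → (∀ x → f x ≤ g x) →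
               ∀ xs → sum (map f xs) ≤ sum (map g xs)
sum-map-mono f≤g []       = z≤n
sum-map-mono f≤g (x ∷ xs) = +-mono-≤ (f≤g x) (sum-map-mono f≤g xs)

-- Recursive trees

module Ancestry (p : ℕ → ℕ) (p≤ : ∀ j → p (suc j) ≤ j) where

  -- Recursion along the path to the root. Parents have smaller numbers than their children, so the
  -- vertex number itself is always enough fuel. The step receives the predecessor of the current
  -- vertex number.
  foldUp : ∀ {A : Set} → A → (ℕ → A → A) → ℕ → ℕ → A
  foldUp z s zero    j       = z
  foldUp z s (suc f) zero    = z
  foldUp z s (suc f) (suc j) = s j (foldUp z s f (p (suc j)))

  foldUp-fuel : ∀ {A : Set} (z : A) s f g j → j ≤ f → j ≤ g → foldUp z s f j ≡ foldUp z s g j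
  foldUp-fuel z s zero    zero    zero    _ _ = refl
  foldUp-fuel z s zero    (suc g) zero    _ _ = refl
  foldUp-fuel z s (suc f) zero    zero    _ _ = refl
  foldUp-fuel z s (suc f) (suc g) zero    _ _ = refl
  foldUp-fuel z s (suc f) (suc g) (suc j) (s≤s a) (s≤s b) =
    cong (s j) (foldUp-fuel z s f g (p (suc j)) (≤-trans (p≤ j) a) (≤-trans (p≤ j) b))

  -- The argument is one less than the vertex, so the case `zero` is vertex 1, where the branch
  -- starts.
  firstStep : ℕ → Bool → Bool
  firstStep zero    _ = true
  firstStep (suc _) b = b

  opaque

    depth : ℕ → ℕ
    depth j = foldUp 0 (const suc) j j

    -- Membership in the branch of vertex 1, the leftmost child of the root 0.
    first : ℕ → Bool
    first j = foldUp false firstStep j j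

    depth-zero : depth 0 ≡ 0
    depth-zero = refl

    depth-suc : ∀ j → depth (suc j) ≡ suc (depth (p (suc j)))
    depth-suc j = cong suc (foldUp-fuel 0 (const suc) j _ (p (suc j)) (p≤ j) ≤-refl)

    first-zero : first 0 ≡ false
    first-zero = refl

    first-one : first 1 ≡ true
    first-one = refl

    first-suc : ∀ j → first (suc (suc j)) ≡ first (p (suc (suc j)))
    first-suc j = foldUp-fuel false firstStep (suc j) _ (p (suc (suc j))) (p≤ (suc j)) ≤-refl

  depth-one : depth 1 ≡ 1
  depth-one = trans (depth-suc 0) (cong suc (trans (cong depth (n≤0⇒n≡0 (p≤ 0))) depth-zero))

  ancestor-induction : (P : ℕ → Set) → P 0 → (∀ j → P (p (suc j)) → P (suc j)) → ∀ j → P j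
  ancestor-induction P base step j = go j j ≤-refl
    where
    go : ∀ m j → j ≤ m → P j
    go m       zero    _       = base
    go (suc m) (suc j) (s≤s h) = step j (go m (p (suc j)) (≤-trans (p≤ j) h))

-- The parent function of the greedy tree

-- The children of `i` form the interval from `used ds i + 1` to `used ds (suc i)`, so the parent of
-- `j` is the last `i` whose interval starts at or before `j`. The default 0 is correct for positive
-- `j`, since `used ds 0` is 0.
greatestBelow : List ℕ → ℕ → ℕ → ℕ
greatestBelow ds zero    j = 0
greatestBelow ds (suc m) j with used ds (suc m) <? j
... | yes _ = suc m
... | no  _ = greatestBelow ds m j

greatestBelow-≤ : ∀ ds m j → greatestBelow ds m j ≤ m
greatestBelow-≤ ds zero    j = z≤n
greatestBelow-≤ ds (suc m) j with used ds (suc m) <? j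
... | yes _ = ≤-refl
... | no  _ = m≤n⇒m≤1+n (greatestBelow-≤ ds m j)

used-greatestBelow : ∀ ds m j → 0 < j → used ds (greatestBelow ds m j) < j
used-greatestBelow ds zero    j 0<j = 0<j
used-greatestBelow ds (suc m) j 0<j with used ds (suc m) <? j
... | yes lt = lt
... | no  _  = used-greatestBelow ds m j 0<j

greatestBelow-max : ∀ ds m j {i} → i ≤ m → used ds i < j → i ≤ greatestBelow ds m j
greatestBelow-max ds zero    j z≤n lt = z≤n
greatestBelow-max ds (suc m) j i≤m lt with used ds (suc m) <? j
... | yes _  = i≤m
... | no ¬lt = greatestBelow-max ds m j (s≤s⁻¹ (≤∧≢⇒< i≤m (λ { refl → ¬lt lt }))) lt

opaque

  parent : List ℕ → ℕ → ℕ
  parent ds zero    = 0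
  parent ds (suc j) = greatestBelow ds j (suc j)

  parent-≤ : ∀ ds j → parent ds (suc j) ≤ j
  parent-≤ ds j = greatestBelow-≤ ds j (suc j)

  used-parent : ∀ ds j → used ds (parent ds (suc j)) < suc j
  used-parent ds j = used-greatestBelow ds j (suc j) z<s

  parent-max : ∀ ds {i j} → i ≤ j → used ds i < suc j → i ≤ parent ds (suc j)
  parent-max ds {i} {j} = greatestBelow-max ds j (suc j)

-- The field `total` says that the down-degrees account for exactly the `n - 1` vertices other than
-- the root.
record IsGreedySeq (n : ℕ) (ds : List ℕ) : Set where
  field
    noninc : ∀ {i j} → i ≤ j → at ds j ≤ at ds i
    total  : suc (used ds n) ≡ n

used-mono : ∀ ds {i j} → i ≤ j → used ds i ≤ used ds j
used-mono ds {i} {j} i≤j = subst (λ m → used ds i ≤ used ds m) (m∸n+n≡m i≤j) (go (j ∸ i))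
  where
  go : ∀ m → used ds i ≤ used ds (m + i)
  go zero    = ≤-refl
  go (suc m) = ≤-trans (go m) (m≤m+n _ _)

-- Structure of a greedy tree: parents, depths and the branch of vertex 1

module Greedy {n : ℕ} {ds : List ℕ} (G : IsGreedySeq n ds) where
  open IsGreedySeq G public
  open Ancestry (parent ds) (parent-≤ ds) public

  private
    p = parent ds
    U = used ds

  used-const : ∀ i m → at ds (suc i) ≤ 1 → U (m + suc i) ≡ U (suc i)
  used-const i zero    _ = refl
  used-const i (suc m) h = begin
    U (m + suc i) + downDeg ds (m + suc i) ≡⟨ cong (λ x → U (m + suc i) + downDeg ds x) (+-suc m i) ⟩
    U (m + suc i) + (at ds (suc (m + i)) ∸ 1)
      ≡⟨ cong (U (m + suc i) +_) (m≤n⇒m∸n≡0 (≤-trans (noninc (s≤s (m≤n+m i m))) h)) ⟩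
    U (m + suc i) + 0                      ≡⟨ +-identityʳ _ ⟩
    U (m + suc i)                          ≡⟨ used-const i m h ⟩
    U (suc i)                              ∎
    where open ≡-Reasoning

  -- By monotonicity the root has at least two children, and each further vertex up to `i`
  -- contributes at least one more.
  used-grows : ∀ {i} → 2 ≤ at ds i → ∀ k → k ≤ i → suc (suc k) ≤ U (suc k)
  used-grows h zero    k≤i = ≤-trans h (noninc z≤n)
  used-grows h (suc k) k≤i =
    ≤-trans (≤-reflexive (+-comm 1 (suc (suc k))))
      (+-mono-≤ (used-grows h k (<⇒≤ k≤i)) (∸-monoˡ-≤ 1 (≤-trans h (noninc k≤i))))

  -- If the next degree is at least 2, so are all earlier ones and `used` runs ahead of the index.
  -- Otherwise all remaining vertices are leaves and `used` has reached its final value `n - 1`.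
  -- Hence the construction never runs out of open vertices too early.
  used-large : ∀ i → suc i ≤ n → suc (suc i) ≤ U (suc i) ⊎ suc (U (suc i)) ≡ n
  used-large i i<n with at ds (suc i) ≤? 1
  ... | yes h = inj₂ (trans (cong suc (trans (sym (used-const i (n ∸ suc i) h)) (cong U (m∸n+n≡m i<n)))) total)
  ... | no  h = inj₁ (used-grows (≰⇒> h) i (n≤1+n i))

  -- Maximality of the parent gives this at once unless the parent is `j` itself, the largest
  -- candidate; then `used-large` decides.
  ≤-used-suc-parent : ∀ {j} → suc j < n → suc j ≤ U (suc (p (suc j)))
  ≤-used-suc-parent {j} j<n with suc j ≤? U (suc (p (suc j)))
  ... | yes h = h
  ... | no  h with suc (p (suc j)) ≤? j
  ...   | yes q = ⊥-elim (1+n≰n (parent-max ds q (≰⇒> h)))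
  ...   | no  q with used-large j (<⇒≤ j<n) | ≤-antisym (parent-≤ ds j) (s≤s⁻¹ (≰⇒> q))
  ...     | inj₁ l | eq = contradiction (≤-trans (n≤1+n _) (subst (λ x → suc (suc j) ≤ U (suc x)) (sym eq) l)) h
  ...     | inj₂ e | eq = contradiction (subst (λ x → suc j ≤ U (suc x)) (sym eq) (s≤s⁻¹ (subst (suc (suc j) ≤_) (sym e) j<n))) h

  parent-unique : ∀ {i j} → suc j < n → U i < suc j → suc j ≤ U (suc i) → p (suc j) ≡ i
  parent-unique {i} {j} j<n lo hi = ≤-antisym a b
    where
    a : p (suc j) ≤ i
    a with p (suc j) ≤? i
    ... | yes h = h
    ... | no  h = ⊥-elim (1+n≰n (≤-trans (used-parent ds j) (≤-trans hi (used-mono ds (≰⇒> h)))))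
    b : i ≤ p (suc j)
    b with i ≤? p (suc j)
    ... | yes h = h
    ... | no  h = ⊥-elim (1+n≰n (≤-trans lo (≤-trans (≤-used-suc-parent j<n) (used-mono ds (≰⇒> h)))))

  parent-mono : ∀ {i j} → i ≤ j → p (suc i) ≤ p (suc j)
  parent-mono {i} i≤j = parent-max ds (≤-trans (parent-≤ ds i) i≤j) (≤-trans (used-parent ds i) (s≤s i≤j))

  parent-≤∸2 : ∀ {j} → suc (suc j) < n → p (suc (suc j)) ≤ j
  parent-≤∸2 {j} j<n with p (suc (suc j)) ≤? j
  ... | yes h = h
  ... | no  h with used-large j (≤-trans (n≤1+n _) (<⇒≤ j<n))
                 | subst (λ x → U x < suc (suc j)) (≤-antisym (parent-≤ ds (suc j)) (≰⇒> h)) (used-parent ds (suc j))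
  ...   | inj₁ l | q = ⊥-elim (1+n≰n (≤-trans q l))
  ...   | inj₂ e | q = ⊥-elim (1+n≰n (≤-trans j<n (subst (_≤ suc (suc j)) e q)))

  parent-< : ∀ {j} → suc j < n → p (suc j) < n
  parent-< {j} j<n = ≤-trans (s≤s (parent-≤ ds j)) (<⇒≤ j<n)

  -- Each step towards the root, except the one from vertex 1, lowers the vertex number by at least
  -- two.
  double-depth-≤ : ∀ j → j < n → depth j + depth j ≤ suc j
  double-depth-≤ = ancestor-induction (λ j → j < n → depth j + depth j ≤ suc j) base step
    where
    base : 0 < n → depth 0 + depth 0 ≤ 1
    base _ rewrite depth-zero = z≤n
    step : ∀ j → (p (suc j) < n → depth (p (suc j)) + depth (p (suc j)) ≤ suc (p (suc j))) →
           suc j < n → depth (suc j) + depth (suc j) ≤ suc (suc j)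
    step zero    ih j<n rewrite depth-one = ≤-refl
    step (suc j) ih j<n rewrite depth-suc (suc j) =
      s≤s (subst (_≤ suc (suc j)) (sym (+-suc _ _))
        (s≤s (≤-trans (ih (parent-< j<n)) (s≤s (parent-≤∸2 j<n)))))

  depth-mono : ∀ j {i} → i ≤ j → depth i ≤ depth j
  depth-mono = ancestor-induction (λ j → ∀ {i} → i ≤ j → depth i ≤ depth j) (λ { z≤n → ≤-refl }) step
    where
    step : ∀ j → (∀ {i} → i ≤ p (suc j) → depth i ≤ depth (p (suc j))) → ∀ {i} → i ≤ suc j → depth i ≤ depth (suc j)
    step j ih {zero}  _       rewrite depth-zero = z≤n
    step j ih {suc i} (s≤s h) rewrite depth-suc j | depth-suc i = s≤s (ih (parent-mono h))

  depth-cancel-< : ∀ {i j} → depth i < depth j → i < j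
  depth-cancel-< {i} {j} lt with i <? j
  ... | yes h = h
  ... | no  h = ⊥-elim (1+n≰n (≤-trans lt (depth-mono i (≮⇒≥ h))))

  -- The branch of vertex 1 is leftmost on every level: monotone parents carry the order of two
  -- vertices of one level up to their ancestors.
  first-left : ∀ j {i} → i ≤ j → depth i ≡ depth j → first j ≡ true → first i ≡ true
  first-left = ancestor-induction
    (λ j → ∀ {i} → i ≤ j → depth i ≡ depth j → first j ≡ true → first i ≡ true) (λ { z≤n _ f → f }) step
    where
    step : ∀ j → (∀ {i} → i ≤ p (suc j) → depth i ≡ depth (p (suc j)) → first (p (suc j)) ≡ true → first i ≡ true) →
           ∀ {i} → i ≤ suc j → depth i ≡ depth (suc j) → first (suc j) ≡ true → first i ≡ true
    step j       ih {zero}        _        e _ = contradiction (trans (sym depth-zero) (trans e (depth-suc j))) 0≢1+n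
    step j       ih {suc zero}    _        _ _ = first-one
    step zero    ih {suc (suc i)} (s≤s ()) _ _
    step (suc j) ih {suc (suc i)} (s≤s h)  e f =
      trans (first-suc i)
        (ih (parent-mono h) (suc-injective (trans (sym (depth-suc (suc i))) (trans e (depth-suc (suc j)))))
            (trans (sym (first-suc j)) f))

  inner-degree : ∀ {j} → suc j < n → 0 < p (suc j) → 2 ≤ at ds (p (suc j))
  inner-degree {j} j<n 0<p = go (p (suc j)) 0<p (≤-trans (used-parent ds j) (≤-used-suc-parent j<n))
    where
    go : ∀ q → 0 < q → U q < U (suc q) → 2 ≤ at ds q
    go (suc q) _ lt = m∸n≢0⇒n<m (>⇒≢ (+-cancelˡ-≤ (U (suc q)) _ _ (≤-trans (≤-reflexive (+-comm (U (suc q)) 1)) lt)))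

  used-strict : ∀ i → 2 ≤ at ds i → suc (U i) ≤ U (suc i)
  used-strict zero    h = <⇒≤ h
  used-strict (suc i) h = ≤-trans (≤-reflexive (+-comm 1 (U (suc i)))) (+-monoʳ-≤ (U (suc i)) (∸-monoˡ-≤ 1 h))

  depth-child : ∀ {i j} → p (suc j) ≡ i → depth (suc j) ≡ suc (depth i)
  depth-child {j = j} e = trans (depth-suc j) (cong (suc ∘ depth) e)

  first-child : ∀ {i j} → p (suc j) ≡ i → first i ≡ true → first (suc j) ≡ true
  first-child {j = zero}  e f = first-one
  first-child {j = suc j} e f = trans (first-suc j) (trans (cong first e) f)

  -- A first vertex on the level of the parent of `j` and not to its right has at least its degree,
  -- hence a child. Its leftmost child is not to the right of `j`.
  first-exists : ∀ j → 0 < j → j < n → ∃ λ u → u ≤ j × depth u ≡ depth j × first u ≡ true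
  first-exists = ancestor-induction
    (λ j → 0 < j → j < n → ∃ λ u → u ≤ j × depth u ≡ depth j × first u ≡ true) (λ ()) step
    where
    step : ∀ j → (0 < p (suc j) → p (suc j) < n → ∃ λ u → u ≤ p (suc j) × depth u ≡ depth (p (suc j)) × first u ≡ true) →
           0 < suc j → suc j < n → ∃ λ u → u ≤ suc j × depth u ≡ depth (suc j) × first u ≡ true
    step j ih _ j<n with 0 <? p (suc j)
    ... | no ¬0<p = 1 , s≤s z≤n ,
          trans depth-one (sym (trans (depth-child (n≤0⇒n≡0 (≮⇒≥ ¬0<p))) (cong suc depth-zero))) , first-one
    ... | yes 0<p with ih 0<p (parent-< j<n)
    ...   | u , u≤p , du , fu = suc (U u) , c≤j , trans (depth-child pc) (trans (cong suc du) (sym (depth-suc j))) , first-child pc fu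
      where
      c≤j : suc (U u) ≤ suc j
      c≤j = ≤-trans (s≤s (used-mono ds u≤p)) (used-parent ds j)
      pc : p (suc (U u)) ≡ u
      pc = parent-unique (≤-trans (s≤s c≤j) j<n) ≤-refl (used-strict u (≤-trans (inner-degree j<n 0<p) (noninc u≤p)))

  -- The last level may lie entirely in the branch of vertex 1, so a vertex one level deeper is
  -- assumed. A nonfirst `u` on the level before that of the parent of `j` has degree at least 2,
  -- and its last child is taken because the leftmost child of the root is vertex 1.
  nonfirst-exists : ∀ j k → j < n → depth j ≡ suc k → ∃ λ u → u < n × depth u ≡ k × first u ≡ false
  nonfirst-exists = ancestor-induction
    (λ j → ∀ k → j < n → depth j ≡ suc k → ∃ λ u → u < n × depth u ≡ k × first u ≡ false)
    (λ k _ e → contradiction (trans (sym depth-zero) e) 0≢1+n) step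
    where
    step : ∀ j → (∀ k → p (suc j) < n → depth (p (suc j)) ≡ suc k → ∃ λ u → u < n × depth u ≡ k × first u ≡ false) →
           ∀ k → suc j < n → depth (suc j) ≡ suc k → ∃ λ u → u < n × depth u ≡ k × first u ≡ false
    step j ih zero    j<n e = 0 , ≤-trans z<s j<n , depth-zero , first-zero
    step j ih (suc k) j<n e with ih k (parent-< j<n) (suc-injective (trans (sym (depth-suc j)) e))
    ... | u , u<n , du , fu = lastChild (U (suc u)) refl
      where
      u<p : u < p (suc j)
      u<p = depth-cancel-< (≤-reflexive (trans (cong suc du) (sym (suc-injective (trans (sym (depth-suc j)) e)))))
      2≤deg : 2 ≤ at ds u
      2≤deg = ≤-trans (inner-degree j<n (≤-trans z<s u<p)) (noninc (<⇒≤ u<p))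
      c≤j : U (suc u) ≤ j
      c≤j = s≤s⁻¹ (≤-trans (s≤s (used-mono ds u<p)) (used-parent ds j))
      lastChild : ∀ c → c ≡ U (suc u) → ∃ λ u → u < n × depth u ≡ suc k × first u ≡ false
      lastChild zero          c≡ = contradiction (subst (2 + u ≤_) (sym c≡) (used-grows 2≤deg u ≤-refl)) λ ()
      lastChild (suc zero)    c≡ = contradiction (subst (2 + u ≤_) (sym c≡) (used-grows 2≤deg u ≤-refl)) λ { (s≤s ()) }
      lastChild (suc (suc c)) c≡ = suc (suc c) , c<n , trans (depth-child pc) (cong suc du) , trans (first-suc c) (trans (cong first pc) fu)
        where
        c<n : suc (suc c) < n
        c<n = ≤-trans (s≤s (subst (_≤ j) (sym c≡) c≤j)) (<⇒≤ j<n)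
        pc : p (suc (suc c)) ≡ u
        pc = parent-unique c<n (subst (U u <_) (sym c≡) (used-strict u 2≤deg)) (≤-reflexive c≡)

-- Distances in a greedy tree in terms of depths

module GreedyGraph {n : ℕ} (d : Vec ℕ n) (G : IsGreedySeq n (toList d)) where
  open Greedy G public
  open Distance (greedyAdj d) public

  private
    p = parent (toList d)
    U = used (toList d)

  data Child (i : ℕ) : ℕ → Set where
    child : ∀ {j} → p (suc j) ≡ i → Child i (suc j)

  childB⇒Child : ∀ i j → j < n → T (childB (toList d) i j) → Child i j
  childB⇒Child i j j<n c with Equivalence.to (T-∧ {i <ᵇ j}) c
  ... | i<j , c′ with Equivalence.to (T-∧ {U i <ᵇ j}) c′
  childB⇒Child i (suc j) j<n c | i<j , c′ | lo , hi = child (parent-unique j<n (<ᵇ⇒< _ _ lo) (≤ᵇ⇒≤ _ _ hi))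

  Child⇒childB : ∀ {i j} → j < n → Child i j → T (childB (toList d) i j)
  Child⇒childB j<n (child {j} refl) = Equivalence.from T-∧
    (<⇒<ᵇ (s≤s (parent-≤ (toList d) j)) , Equivalence.from T-∧ (<⇒<ᵇ (used-parent (toList d) j) , ≤⇒≤ᵇ (≤-used-suc-parent j<n)))

  adj⇒Child : ∀ u v → T (greedyAdj d u v) → Child (toℕ u) (toℕ v) ⊎ Child (toℕ v) (toℕ u)
  adj⇒Child u v uv with Equivalence.to T-∨ uv
  ... | inj₁ c = inj₁ (childB⇒Child _ _ (toℕ<n v) c)
  ... | inj₂ c = inj₂ (childB⇒Child _ _ (toℕ<n u) c)

  Child⇒adj : ∀ u v → Child (toℕ v) (toℕ u) → T (greedyAdj d u v)
  Child⇒adj u v c = Equivalence.from T-∨ (inj₂ (Child⇒childB (toℕ<n u) c))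

  adj-sym : ∀ {u v} → T (greedyAdj d u v) → T (greedyAdj d v u)
  adj-sym {u} {v} = subst T (∨-comm (childB (toList d) (toℕ u) (toℕ v)) _)

  signed : ℕ → Bool → ℕ → ℕ
  signed N true  k = N + k
  signed N false k = N ∸ k

  -- The signed depth (positive on the branch of vertex 1), shifted by N.
  height : ℕ → ℕ → ℕ
  height N j = signed N (first j) (depth j)

  signed-suc : ∀ N b k → signed N b k ≤ suc (signed N b (suc k)) × signed N b (suc k) ≤ suc (signed N b k)
  signed-suc N true  k rewrite +-suc N k = ≤-trans (n≤1+n _) (n≤1+n _) , ≤-refl
  signed-suc zero    false zero    = z≤n , z≤n
  signed-suc (suc N) false zero    = ≤-refl , ≤-trans (n≤1+n _) (n≤1+n _)
  signed-suc zero    false (suc k) = z≤n , z≤n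
  signed-suc (suc N) false (suc k) = signed-suc N false k

  height-child : ∀ N {i j} → Child i j → height N i ≤ suc (height N j) × height N j ≤ suc (height N i)
  -- The edge from the root to vertex 1 is the only one along which `first` changes. The root has
  -- depth 0, so its sign is immaterial.
  height-child N (child {zero} refl)
    rewrite n≤0⇒n≡0 (parent-≤ (toList d) 0) | first-zero | first-one | depth-zero | depth-one | +-comm N 1 =
      ≤-trans (n≤1+n N) (n≤1+n _) , ≤-refl
  height-child N (child {suc j} refl) rewrite depth-suc (suc j) | first-suc j = signed-suc N (first (p (suc (suc j)))) _

  height-lipschitz : ∀ N → Lipschitz (height N ∘ toℕ)
  height-lipschitz N u v uv with adj⇒Child u v uv
  ... | inj₁ c = height-child N c
  ... | inj₂ c = proj₂ (height-child N c) , proj₁ (height-child N c)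

  private
    -- Taking N = depth v makes v the zero of the potential.
    height-u : ∀ {u} v → first u ≡ true → height (depth v) u ≡ depth v + depth u
    height-u v fu rewrite fu = refl

    height-v : ∀ {v} → first v ≡ false → height (depth v) v ≡ 0
    height-v {v} fv rewrite fv = n∸n≡0 (depth v)

  -- Ensures that the lower bound on the distance does not exceed the fuel of the search.
  depth+depth≤n : ∀ (u v : Fin n) → depth (toℕ u) + depth (toℕ v) ≤ n
  depth+depth≤n u v with ≤-total (toℕ u) (toℕ v)
  ... | inj₁ u≤v = ≤-trans (+-monoˡ-≤ _ (depth-mono _ u≤v)) (≤-trans (double-depth-≤ _ (toℕ<n v)) (toℕ<n v))
  ... | inj₂ v≤u = ≤-trans (+-monoʳ-≤ _ (depth-mono _ v≤u)) (≤-trans (double-depth-≤ _ (toℕ<n u)) (toℕ<n u))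

  -- Exactly one of the vertices is first. Shifting by the depth of the other one makes the
  -- difference of their heights the sum of the depths, and the height changes by at most one along
  -- an edge.
  dist-≥-depths : ∀ u v → first (toℕ u) ≢ first (toℕ v) → depth (toℕ u) + depth (toℕ v) ≤ dist (greedyAdj d) u v
  dist-≥-depths u v ne = dist-≥ u v (depth+depth≤n u v) low
    where
    low : ∀ k → Within k u v → depth (toℕ u) + depth (toℕ v) ≤ k
    low k uv with first (toℕ u) in fu | first (toℕ v) in fv
    ... | true  | true  = contradiction refl ne
    ... | false | false = contradiction refl ne
    ... | true  | false
      with a ← proj₁ (within-lipschitz {height (depth (toℕ v)) ∘ toℕ} (height-lipschitz (depth (toℕ v))) k {u} {v} uv)
      rewrite height-u (toℕ v) fu | height-v fv = ≤-trans (≤-reflexive (+-comm (depth (toℕ u)) _)) a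
    ... | false | true
      with a ← proj₂ (within-lipschitz {height (depth (toℕ u)) ∘ toℕ} (height-lipschitz (depth (toℕ u))) k {u} {v} uv)
      rewrite height-u (toℕ u) fv | height-v fu = a

  ascend-step : ∀ {j k} {u v : Fin n} → toℕ u ≡ suc j →
                (∀ w → toℕ w ≡ p (suc j) → Within k w v) → Within (suc k) u v
  ascend-step {j} {k} {u} {v} u≡ h =
    subst (λ m → Within m u v) (+-comm k 1)
      (within-trans 1 k {u} {w} {v} (within-edge {u} {w} (Child⇒adj u w c)) (h w w≡))
    where
    j<n : suc j < n
    j<n = subst (_< n) u≡ (toℕ<n u)
    w : Fin n
    w = fromℕ< (parent-< j<n)
    w≡ : toℕ w ≡ p (suc j)
    w≡ = toℕ-fromℕ< (parent-< j<n)
    c : Child (toℕ w) (toℕ u)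
    c = subst (Child (toℕ w)) (sym u≡) (child (sym w≡))

  ascend-root : ∀ v → toℕ v ≡ 0 → ∀ j u → toℕ u ≡ j → Within (depth j) u v
  ascend-root v v≡ = ancestor-induction (λ j → ∀ u → toℕ u ≡ j → Within (depth j) u v)
    (λ u u≡ → subst (λ m → Within m u v) (sym depth-zero) (within-refl {u} {v} (trans u≡ (sym v≡))))
    (λ j ih u u≡ → subst (λ m → Within m u v) (sym (depth-suc j)) (ascend-step {k = depth (p (suc j))} {u} {v} u≡ ih))

  -- Inside its branch the climb stops at vertex 1, one edge short of the root.
  ascend-one : ∀ v → toℕ v ≡ 1 → ∀ j → first j ≡ true → ∃ λ k → depth j ≡ suc k × ∀ u → toℕ u ≡ j → Within k u v
  ascend-one v v≡ = ancestor-induction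
    (λ j → first j ≡ true → ∃ λ k → depth j ≡ suc k × ∀ u → toℕ u ≡ j → Within k u v)
    (λ f → contradiction (trans (sym first-zero) f) λ ()) step
    where
    step : ∀ j → (first (p (suc j)) ≡ true → ∃ λ k → depth (p (suc j)) ≡ suc k × ∀ u → toℕ u ≡ p (suc j) → Within k u v) →
           first (suc j) ≡ true → ∃ λ k → depth (suc j) ≡ suc k × ∀ u → toℕ u ≡ suc j → Within k u v
    step zero    ih f = 0 , depth-one , λ u u≡ → within-refl {u} {v} (trans u≡ (sym v≡))
    step (suc j) ih f with ih (trans (sym (first-suc j)) f)
    ... | k , dk , h = suc k , trans (depth-suc (suc j)) (cong suc dk) , λ u u≡ → ascend-step {k = k} {u} {v} u≡ h

  dist-≤-depths : ∀ u v → dist (greedyAdj d) u v ≤ depth (toℕ u) + depth (toℕ v)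
  dist-≤-depths u v = dist-≤ u v (subst (λ m → Within m u v) (+-comm (depth (toℕ v)) _)
    (within-trans (depth (toℕ u)) (depth (toℕ v)) {u} {r} {v} (ascend-root r r≡ _ u refl)
      (within-sym (λ {x} {y} → adj-sym {x} {y}) (depth (toℕ v)) {v} {r} (ascend-root r r≡ _ v refl))))
    where
    0<n : 0 < n
    0<n = ≤-trans z<s (toℕ<n u)
    r : Fin n
    r = fromℕ< 0<n
    r≡ : toℕ r ≡ 0
    r≡ = toℕ-fromℕ< 0<n

  -- The walk through vertex 1 avoids the root and so saves two edges.
  dist-<-depths : ∀ u v → first (toℕ u) ≡ true → first (toℕ v) ≡ true →
                  dist (greedyAdj d) u v < depth (toℕ u) + depth (toℕ v)
  dist-<-depths u v fu fv = go (ascend-one r r≡ _ fu) (ascend-one r r≡ _ fv)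
    where
    1<n : ∀ j → j < n → first j ≡ true → 1 < n
    1<n zero    j<n f = contradiction (trans (sym first-zero) f) λ ()
    1<n (suc j) j<n f = ≤-trans (s≤s (s≤s z≤n)) j<n
    r : Fin n
    r = fromℕ< (1<n _ (toℕ<n u) fu)
    r≡ : toℕ r ≡ 1
    r≡ = toℕ-fromℕ< (1<n _ (toℕ<n u) fu)
    go : (∃ λ k → depth (toℕ u) ≡ suc k × ∀ w → toℕ w ≡ toℕ u → Within k w r) →
         (∃ λ k → depth (toℕ v) ≡ suc k × ∀ w → toℕ w ≡ toℕ v → Within k w r) →
         dist (greedyAdj d) u v < depth (toℕ u) + depth (toℕ v)
    go (k , dk , hk) (l , dl , hl) rewrite dk | dl = s≤s (≤-trans
      (dist-≤ u v (within-trans k l {u} {r} {v} (hk u refl) (within-sym (λ {x} {y} → adj-sym {x} {y}) l {v} {r} (hl v refl))))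
      (≤-trans (≤-reflexive (+-comm l k)) (+-monoʳ-≤ k (n≤1+n l))))


-- Parents, depths and branches of two greedy trees with comparable child counts

module Comparison {n : ℕ} {ds′ ds″ : List ℕ} (G′ : IsGreedySeq n ds′) (G″ : IsGreedySeq n ds″)
                  (used-≤ : ∀ i → i ≤ n → used ds′ i ≤ used ds″ i) where
  private
    module T′ = Greedy G′
    module T″ = Greedy G″
    p′ = parent ds′
    p″ = parent ds″

  -- In the second tree the vertices up to `p′ (suc j)` have at least as many children as in the
  -- first, so they already cover `suc j`.
  parent-antitone : ∀ {j} → suc j < n → p″ (suc j) ≤ p′ (suc j)
  parent-antitone {j} j<n with p″ (suc j) ≤? p′ (suc j)
  ... | yes h = h
  ... | no  h = ⊥-elim (1+n≰n (≤-trans (used-parent ds″ j) (≤-trans (T′.≤-used-suc-parent j<n)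
                  (≤-trans (used-≤ _ (T′.parent-< j<n)) (used-mono ds″ (≰⇒> h))))))

  depth-antitone : ∀ j → j < n → T″.depth j ≤ T′.depth j
  depth-antitone = T′.ancestor-induction (λ j → j < n → T″.depth j ≤ T′.depth j)
    (λ _ → ≤-reflexive (trans T″.depth-zero (sym T′.depth-zero))) step
    where
    step : ∀ j → (p′ (suc j) < n → T″.depth (p′ (suc j)) ≤ T′.depth (p′ (suc j))) →
           suc j < n → T″.depth (suc j) ≤ T′.depth (suc j)
    step j ih j<n rewrite T″.depth-suc j | T′.depth-suc j =
      s≤s (≤-trans (T″.depth-mono _ (parent-antitone j<n)) (ih (T′.parent-< j<n)))

  -- Equal depths of `j` force both of its parents onto one level of the second tree and keep the
  -- depth of the old parent. By induction the old parent is first there, and the new one is not to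
  -- its right.
  first-transfer : ∀ j → j < n → T″.depth j ≡ T′.depth j → T′.first j ≡ true → T″.first j ≡ true
  first-transfer = T′.ancestor-induction
    (λ j → j < n → T″.depth j ≡ T′.depth j → T′.first j ≡ true → T″.first j ≡ true)
    (λ _ _ f → contradiction (trans (sym T′.first-zero) f) λ ()) step
    where
    step : ∀ j → (p′ (suc j) < n → T″.depth (p′ (suc j)) ≡ T′.depth (p′ (suc j)) →
                  T′.first (p′ (suc j)) ≡ true → T″.first (p′ (suc j)) ≡ true) →
           suc j < n → T″.depth (suc j) ≡ T′.depth (suc j) → T′.first (suc j) ≡ true → T″.first (suc j) ≡ true
    step zero    ih j<n e f = T″.first-one
    step (suc j) ih j<n e f = trans (T″.first-suc j)
      (T″.first-left _ p″≤p′ (≤-antisym a (≤-trans b c))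
        (ih p′<n (≤-antisym b (≤-trans c a)) (trans (sym (T′.first-suc j)) f)))
      where
      p″≤p′ : p″ (suc (suc j)) ≤ p′ (suc (suc j))
      p″≤p′ = parent-antitone j<n
      p′<n : p′ (suc (suc j)) < n
      p′<n = T′.parent-< j<n
      a : T″.depth (p″ (suc (suc j))) ≤ T″.depth (p′ (suc (suc j)))
      a = T″.depth-mono _ p″≤p′
      b : T″.depth (p′ (suc (suc j))) ≤ T′.depth (p′ (suc (suc j)))
      b = depth-antitone _ p′<n
      c : T′.depth (p′ (suc (suc j))) ≤ T″.depth (p″ (suc (suc j)))
      c = ≤-reflexive (suc-injective (trans (sym (T′.depth-suc (suc j))) (trans (sym e) (T″.depth-suc (suc j)))))

-- Vertexwise comparison of eccentricities

module EccComparison {m : ℕ} (d′ d″ : Vec ℕ (suc (suc m)))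
                     (G′ : IsGreedySeq (suc (suc m)) (toList d′)) (G″ : IsGreedySeq (suc (suc m)) (toList d″))
                     (used-≤ : ∀ i → i ≤ suc (suc m) → used (toList d′) i ≤ used (toList d″) i) where
  open Comparison G′ G″ used-≤
  private
    module T′ = GreedyGraph d′ G′
    module T″ = GreedyGraph d″ G″

    n last : ℕ
    n = suc (suc m)
    last = suc m

  dist-≤-ecc : ∀ (z : Fin n) j → j < n → T′.first (toℕ z) ≢ T′.first j →
               T′.depth (toℕ z) + T′.depth j ≤ ecc (greedyAdj d′) z
  dist-≤-ecc z j j<n ne = ≤-trans
    (subst (λ x → T′.depth (toℕ z) + T′.depth x ≤ dist (greedyAdj d′) z u) u≡
      (T′.dist-≥-depths z u (λ e → ne (trans e (cong T′.first u≡)))))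
    (T′.dist≤ecc z u)
    where
    u : Fin n
    u = fromℕ< j<n
    u≡ : toℕ u ≡ j
    u≡ = toℕ-fromℕ< j<n

  depth-≤-last : ∀ (w : Fin n) → T″.depth (toℕ w) ≤ T″.depth last
  depth-≤-last w = T″.depth-mono _ (s≤s⁻¹ (toℕ<n w))

  -- A deepest vertex `j` of opposite type makes the eccentricity of `z` in the first tree at least
  -- the depth of `z` plus the height. In the second tree no distance from `z` exceeds the
  -- corresponding sum, whose terms are no larger.
  ecc-from-full-depth : ∀ (z : Fin n) j → j < n → T′.depth j ≡ T′.depth last → T′.first (toℕ z) ≢ T′.first j →
                        ecc (greedyAdj d″) z ≤ ecc (greedyAdj d′) z
  ecc-from-full-depth z j j<n dj ne = T″.ecc-≤ z λ w → ≤-trans (T″.dist-≤-depths z w) (≤-trans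
    (+-mono-≤ (depth-antitone _ (toℕ<n z))
      (≤-trans (depth-≤-last w) (≤-trans (depth-antitone last ≤-refl) (≤-reflexive (sym dj)))))
    (dist-≤-ecc z j j<n ne))

  -- Here the deepest level of T′ lies in the branch of z, so ecc′ z may fall one short of
  -- depth′ z + depth′ last; if T″ attains the same depths, its deepest level lies in that branch too.
  ecc-from-first : ∀ (z : Fin n) → T′.first (toℕ z) ≡ true → T′.first last ≡ true →
                   ecc (greedyAdj d″) z ≤ ecc (greedyAdj d′) z
  ecc-from-first z fz fl with T′.nonfirst-exists last _ ≤-refl (T′.depth-suc m)
  ... | u , u<n , du , fu = T″.ecc-≤ z bound
    where
    Dz″ = T″.depth (toℕ z)
    Dz′ = T′.depth (toℕ z)
    -- The nonfirst vertex `u` lies one level above the last, so it gives the depth of `z` plus the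
    -- height, minus one.
    low : ∀ {x} → suc x ≤ Dz′ + T′.depth last → x ≤ ecc (greedyAdj d′) z
    low x< = ≤-trans
      (s≤s⁻¹ (≤-trans x< (≤-reflexive (trans (cong (Dz′ +_) (trans (T′.depth-suc m) (cong suc (sym du)))) (+-suc Dz′ _)))))
      (dist-≤-ecc z u u<n (λ e → contradiction (trans (sym fz) (trans e fu)) λ ()))
    bound : ∀ w → dist (greedyAdj d″) z w ≤ ecc (greedyAdj d′) z
    bound w with suc (Dz″ + T″.depth (toℕ w)) ≤? Dz′ + T′.depth last
    ... | yes lt = ≤-trans (T″.dist-≤-depths z w) (low lt)
    -- Here all the depth inequalities are equalities. Hence `z` and `w` are both first in the
    -- second tree, and the strict distance bound supplies the missing unit.
    ... | no  ≮  = low (≤-trans (T″.dist-<-depths z w fz″ fw″) upper)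
      where
      z≤ : Dz″ ≤ Dz′
      z≤ = depth-antitone _ (toℕ<n z)
      l≤ : T″.depth last ≤ T′.depth last
      l≤ = depth-antitone last ≤-refl
      w≤ : T″.depth (toℕ w) ≤ T′.depth last
      w≤ = ≤-trans (depth-≤-last w) l≤
      upper : Dz″ + T″.depth (toℕ w) ≤ Dz′ + T′.depth last
      upper = +-mono-≤ z≤ w≤
      ge : Dz′ + T′.depth last ≤ Dz″ + T″.depth (toℕ w)
      ge = ≮⇒≥ ≮
      z≡ : Dz″ ≡ Dz′
      z≡ = ≤-antisym z≤ (+-cancelʳ-≤ (T′.depth last) _ _ (≤-trans ge (+-monoʳ-≤ Dz″ w≤)))
      w≥ : T′.depth last ≤ T″.depth (toℕ w)
      w≥ = +-cancelˡ-≤ Dz′ _ _ (≤-trans ge (+-monoˡ-≤ _ z≤))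
      fz″ : T″.first (toℕ z) ≡ true
      fz″ = first-transfer _ (toℕ<n z) z≡ fz
      fl″ : T″.first last ≡ true
      fl″ = first-transfer last ≤-refl (≤-antisym l≤ (≤-trans w≥ (depth-≤-last w))) fl
      fw″ : T″.first (toℕ w) ≡ true
      fw″ = T″.first-left last (s≤s⁻¹ (toℕ<n w)) (≤-antisym (depth-≤-last w) (≤-trans l≤ w≥)) fl″

  ecc-antitone : ∀ z → ecc (greedyAdj d″) z ≤ ecc (greedyAdj d′) z
  ecc-antitone z with T′.first (toℕ z) in fz | T′.first last in fl
  ... | true  | true  = ecc-from-first z fz fl
  ... | true  | false = ecc-from-full-depth z last ≤-refl refl (λ e → contradiction (trans (sym fz) (trans e fl)) λ ())
  -- The last level always contains a first vertex, which is of the opposite type to `z`.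
  ... | false | _     with T′.first-exists last z<s ≤-refl
  ...   | u , u≤ , du , fu = ecc-from-full-depth z u (s≤s u≤) du (λ e → contradiction (trans (sym fz) (trans e fu)) λ ())

-- Degree sequences

at-lookup : ∀ {n} (d : Vec ℕ n) (i : Fin n) → at (toList d) (toℕ i) ≡ lookup d i
at-lookup (x ∷ d) Fin.zero    = refl
at-lookup (x ∷ d) (Fin.suc i) = at-lookup d i

at-≥-length : ∀ ds j → length ds ≤ j → at ds j ≡ 0
at-≥-length []       j       _       = refl
at-≥-length (x ∷ ds) (suc j) (s≤s h) = at-≥-length ds j h

at-noninc : ∀ {n} (d : Vec ℕ n) → NonIncreasing d → ∀ {i j} → i ≤ j → at (toList d) j ≤ at (toList d) i
at-noninc {n} d noninc {i} {j} i≤j with j <? n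
... | no  j≮n rewrite at-≥-length (toList d) j (≤-trans (≤-reflexive (length-toList d)) (≮⇒≥ j≮n)) = z≤n
... | yes j<n = go (fromℕ< i<n) (fromℕ< j<n) (toℕ-fromℕ< i<n) (toℕ-fromℕ< j<n)
  where
  i<n : i < n
  i<n = ≤-trans (s≤s i≤j) j<n
  go : ∀ (a b : Fin n) → toℕ a ≡ i → toℕ b ≡ j → at (toList d) j ≤ at (toList d) i
  go a b refl refl rewrite at-lookup d a | at-lookup d b = noninc a b i≤j

sum-take-suc : ∀ k ds → sum (take (suc k) ds) ≡ sum (take k ds) + at ds k
sum-take-suc zero    []       = refl
sum-take-suc (suc k) []       = refl
sum-take-suc zero    (x ∷ ds) = +-identityʳ x
sum-take-suc (suc k) (x ∷ ds) = trans (cong (x +_) (sum-take-suc k ds)) (sym (+-assoc x _ _))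

-- Each of the vertices 1 to `k` spends one unit of its degree on the edge to its parent. Positivity
-- makes the truncated subtraction in `downDeg` exact.
sum-take≡used : ∀ {n} (d : Vec ℕ n) → (∀ i → 1 ≤ lookup d i) →
                ∀ k → suc k ≤ n → sum (take (suc k) (toList d)) ≡ used (toList d) (suc k) + k
sum-take≡used d pos zero    _   = trans (sum-take-suc 0 (toList d)) (sym (+-identityʳ _))
sum-take≡used {n} d pos (suc k) k<n = begin
  sum (take (suc (suc k)) ds)                          ≡⟨ sum-take-suc (suc k) ds ⟩
  sum (take (suc k) ds) + at ds (suc k)                ≡⟨ cong (_+ at ds (suc k)) (sum-take≡used d pos k (<⇒≤ k<n)) ⟩
  (used ds (suc k) + k) + at ds (suc k)                ≡⟨ cong ((used ds (suc k) + k) +_) (m∸n+n≡m at≥1) ⟨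
  (used ds (suc k) + k) + (at ds (suc k) ∸ 1 + 1)      ≡⟨ interchange +-commutativeSemigroup (used ds (suc k)) k _ 1 ⟩
  (used ds (suc k) + (at ds (suc k) ∸ 1)) + (k + 1)    ≡⟨ cong ((used ds (suc k) + (at ds (suc k) ∸ 1)) +_) (+-comm k 1) ⟩
  used ds (suc (suc k)) + suc k                        ∎
  where
  open ≡-Reasoning
  ds = toList d
  at≥1 : 1 ≤ at ds (suc k)
  at≥1 = subst (λ x → 1 ≤ at ds x) (toℕ-fromℕ< k<n) (subst (1 ≤_) (sym (at-lookup d (fromℕ< k<n))) (pos (fromℕ< k<n)))

isGreedySeq : ∀ {m} (d : Vec ℕ (suc m)) → NonIncreasing d → (∀ i → 1 ≤ lookup d i) →
              sum (toList d) ≡ 2 * m → IsGreedySeq (suc m) (toList d)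
isGreedySeq {m} d noninc pos total = record
  { noninc = at-noninc d noninc
  ; total  = cong suc (+-cancelʳ-≡ m _ _ (begin
      used (toList d) (suc m) + m     ≡⟨ sum-take≡used d pos m ≤-refl ⟨
      sum (take (suc m) (toList d))   ≡⟨ cong sum (take-all (suc m) (toList d) (≤-reflexive (length-toList d))) ⟩
      sum (toList d)                  ≡⟨ total ⟩
      m + (m + 0)                     ≡⟨ cong (m +_) (+-identityʳ m) ⟩
      m + m                           ∎)) }
  where open ≡-Reasoning

majorized⇒used-≤ : ∀ {m} (d′ d″ : Vec ℕ (suc m)) → (∀ i → 1 ≤ lookup d′ i) → (∀ i → 1 ≤ lookup d″ i) →
                   IsGreedySeq (suc m) (toList d′) → IsGreedySeq (suc m) (toList d″) →
                   d′ ◁ d″ → ∀ i → i ≤ suc m → used (toList d′) i ≤ used (toList d″) i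
majorized⇒used-≤ d′ d″ pos′ pos″ G′ G″ maj zero    _ = z≤n
majorized⇒used-≤ {m} d′ d″ pos′ pos″ G′ G″ (maj , _) (suc i) h with suc i <? suc m
... | yes lt = +-cancelʳ-≤ i _ _ (subst₂ _≤_ (sum-take≡used d′ pos′ i h) (sum-take≡used d″ pos″ i h) (maj (suc i) (s≤s z≤n) lt))
-- For the full sequence the prefix inequalities of `◁` give nothing, but both counts equal the
-- number of vertices other than the root.
... | no ≮ with refl ← ≤-antisym h (≮⇒≥ ≮) =
  ≤-reflexive (suc-injective (trans (IsGreedySeq.total G′) (sym (IsGreedySeq.total G″))))

theorem3p13 : ∀ {n} (π′ π″ : Vec ℕ n) →
    IsTreeDegSeq π′ → NonIncreasing π′ →
    IsTreeDegSeq π″ → NonIncreasing π″ →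
    π′ ◁ π″ →
    Ecc (greedyAdj π′) ≥ Ecc (greedyAdj π″)
theorem3p13 (x ∷ []) (y ∷ []) (inj₁ (_ , refl)) _ (inj₁ (_ , refl)) _ _ = ≤-refl
theorem3p13 π′ π″ (inj₁ (refl , _)) _ (inj₂ (s≤s () , _)) _ _
theorem3p13 π′ π″ (inj₂ (s≤s () , _)) _ (inj₁ (refl , _)) _ _
theorem3p13 {suc (suc m)} π′ π″ (inj₂ (_ , pos′ , sum′)) noninc′ (inj₂ (_ , pos″ , sum″)) noninc″ maj =
  sum-map-mono (EccComparison.ecc-antitone π′ π″ G′ G″ (majorized⇒used-≤ π′ π″ pos′ pos″ G′ G″ maj)) (allFin _)
  where
  G′ : IsGreedySeq (suc (suc m)) (toList π′)
  G′ = isGreedySeq π′ noninc′ pos′ sum′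
  G″ : IsGreedySeq (suc (suc m)) (toList π″)
  G″ = isGreedySeq π″ noninc″ pos″ sum″
theorem3p13 {suc zero} _ _ (inj₂ (s≤s () , _)) _ (inj₂ _) _ _
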